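{- Let $h(t)=\sum_{i=0}^{d} h_i t^i$ be a polynomial of degree $d$ with nonnegative integer coefficients that is palindromic, i.e. $h_i=h_{d-i}$ for every $0\le i\le d$. If the $\gamma$-vector $\gamma(h)=(\gamma_0,\gamma_1,\ldots,\gamma_{\lfloor d/2\rfloor})$ of $h(t)$ is an $O$-sequence, then the $g$-vector $g(h)=(g_0,g_1,\ldots,g_{\lfloor d/2\rfloor})$ of $h(t)$ is a pure $O$-sequence.
   Context: The $\gamma$-vector: a palindromic polynomial $h(t)=\sum_{i=0}^d h_it^i$ of degree $d$ has a unique expression $h(t)=\sum_{j=0}^{\lfloor d/2\rfloor}\gamma_j\,t^j(1+t)^{d-2j}$, and $\gamma(h)=(\gamma_0,\gamma_1,\ldots,\gamma_{\lfloor d/2\rfloor})$. The $g$-vector: $g(h)=(g_0,\ldots,g_{\lfloor d/2\rfloor})$ is defined by $g_0=h_0$ and $g_i=h_i-h_{i-1}$ for $1\le i\le\lfloor d/2\rfloor$. A multicomplex is a finite nonempty set $M$ of monomials (in finitely many commuting variables) such that whenever $u\in M$ and $v$ divides $u$, then $v\in M$. For $i\ge 0$, $f_i(M)$ denotes the number of monomials of degree $i$ in $M$. A multicomplex is pure if all its maximal monomials (with respect to divisibility) have the same degree. A sequence $(a_0,a_1,\ldots,a_s)$ is an $O$-sequence if there is a multicomplex $M$ with $f_i(M)=a_i$ for $0\le i\le s$ and $f_i(M)=0$ for $i>s$; it is a pure $O$-sequence if such an $M$ can be chosen to be pure. -}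

module Defs where

open import Data.Nat as ℕ using (ℕ; zero; suc; _∸_; ⌊_/2⌋; _≤_; _<_)
open import Data.Integer as ℤ using (ℤ; +_)
open import Data.Integer.Properties using (+-0-commutativeMonoid)
open import Data.Fin using (Fin; zero; suc; toℕ)
open import Data.Vec using (Vec; zipWith)
import Data.Vec as Vec
open import Data.Vec.Functional using (Vector)
open import Data.List using (List; []; length; filter)
open import Data.List.Membership.Propositional using (_∈_)
open import Data.List.Relation.Unary.Unique.Propositional using (Unique)
open import Data.Product using (Σ-syntax; ∃-syntax; _×_)
open import Relation.Binary.PropositionalEquality using (_≡_; _≢_)
open import Algebra.Properties.CommutativeMonoid.Sum +-0-commutativeMonoid
  using (sum)

-- A polynomial is given by its coefficient sequence; two polynomials are
-- equal when all their coefficients agree.  Finiteness of the support is not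
-- built into the type: for h it is part of HasDegree, and the operations
-- below preserve it.
Poly : Set
Poly = ℕ → ℤ

1ₚ : Poly
1ₚ zero    = + 1
1ₚ (suc _) = + 0

X : Poly
X zero          = + 0
X (suc zero)    = + 1
X (suc (suc _)) = + 0

infixl 6 _+ₚ_
infixl 7 _*ₚ_
infixr 7 _·ₚ_
infixr 8 _^ₚ_

_+ₚ_ : Poly → Poly → Poly
(p +ₚ q) k = p k ℤ.+ q k

_*ₚ_ : Poly → Poly → Poly
(p *ₚ q) k = sum {suc k} λ i → p (toℕ i) ℤ.* q (k ∸ toℕ i)

_·ₚ_ : ℤ → Poly → Poly
(c ·ₚ p) k = c ℤ.* p k

_^ₚ_ : Poly → ℕ → Poly
p ^ₚ zero  = 1ₚ
p ^ₚ suc n = p *ₚ (p ^ₚ n)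

∑ₚ : ∀ {n} → Vector Poly n → Poly
∑ₚ ps k = sum λ j → ps j k

HasDegree : ℕ → (ℕ → ℕ) → Set
HasDegree d h = h d ≢ 0 × (∀ i → d < i → h i ≡ 0)

Palindromic : ℕ → (ℕ → ℕ) → Set
Palindromic d h = ∀ i → i ≤ d → h i ≡ h (d ∸ i)

-- The truncated subtraction is exact, since j ≤ ⌊ d /2⌋.
Isγ-vector : (d : ℕ) → (ℕ → ℕ) → Vector ℤ (suc ⌊ d /2⌋) → Set
Isγ-vector d h γ =
  ∀ k → + h k ≡
    ∑ₚ (λ j → γ j ·ₚ (X ^ₚ toℕ j *ₚ (1ₚ +ₚ X) ^ₚ (d ∸ 2 ℕ.* toℕ j))) k

g-vector : (d : ℕ) → (ℕ → ℕ) → Vector ℤ (suc ⌊ d /2⌋)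
g-vector d h zero    = + h 0
g-vector d h (suc i) = + h (suc (toℕ i)) ℤ.- + h (toℕ i)

-- A monomial in n commuting variables is its vector of exponents, so that
-- multiplying monomials adds exponents.
Monomial : ℕ → Set
Monomial n = Vec ℕ n

infixl 7 _·_
infix 4 _∣_

_·_ : ∀ {n} → Monomial n → Monomial n → Monomial n
_·_ = zipWith ℕ._+_

_∣_ : ∀ {n} → Monomial n → Monomial n → Set
v ∣ u = ∃[ w ] w · v ≡ u

deg : ∀ {n} → Monomial n → ℕ
deg = Vec.sum

-- The finite set of monomials is a list without repetitions, so that lengths
-- of sublists are cardinalities.
record Multicomplex (n : ℕ) : Set where
  field
    monomials : List (Monomial n)
    unique    : Unique monomials
    nonempty  : monomials ≢ []
    closed    : ∀ {u v} → u ∈ monomials → v ∣ u → v ∈ monomials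

open Multicomplex public

f : ∀ {n} → ℕ → Multicomplex n → ℕ
f i M = length (filter (λ u → deg u ℕ.≟ i) (monomials M))

Maximal : ∀ {n} → Multicomplex n → Monomial n → Set
Maximal M u = u ∈ monomials M × (∀ v → v ∈ monomials M → u ∣ v → v ≡ u)

Pure : ∀ {n} → Multicomplex n → Set
Pure M = ∀ u v → Maximal M u → Maximal M v → deg u ≡ deg v

HasFVector : ∀ {n s} → Multicomplex n → Vector ℤ (suc s) → Set
HasFVector {s = s} M a =
  (∀ i → + f (toℕ i) M ≡ a i) × (∀ i → s < i → f i M ≡ 0)

IsOSequence : ∀ {s} → Vector ℤ (suc s) → Set
IsOSequence a = ∃[ n ] Σ[ M ∈ Multicomplex n ] HasFVector M a

IsPureOSequence : ∀ {s} → Vector ℤ (suc s) → Set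
IsPureOSequence a = ∃[ n ] Σ[ M ∈ Multicomplex n ] (Pure M × HasFVector M a)

{-# OPTIONS --safe #-}

-- Start from a multicomplex M with f-vector γ and add square-free variables
-- x₁, …, x_d one at a time, multiplying by x_p only those monomials whose degree
-- becomes at most p/2.  Reading x_p as a down step at time p, each monomial of M
-- of degree j is extended by the ballot sequences of length d − 2j, which are
-- counted by the coefficients of (1 − t)(1 + t)^(d−2j) in degree at most d/2 − j;
-- summing over M gives the g-vector.  In a monomial of degree below ⌊d/2⌋ the
-- last missing variable may be added, whence purity.

module Submission where

open import Defs
open import Data.Bool using (true; false; if_then_else_)
open import Data.Fin using (zero; suc; toℕ)
open import Data.Fin.Properties using (toℕ<n)
open import Data.Integer as ℤ using (ℤ; +_)
import Data.Integer.Properties as ℤₚ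
open import Data.Integer.Tactic.RingSolver using (solve-∀)
open import Data.List using (List; []; _∷_; _++_; length; filter; map)
open import Data.List.Membership.Propositional using (_∈_)
open import Data.List.Membership.Propositional.Properties
open import Data.List.Properties using (length-++; filter-++; filter-accept; filter-reject)
import Data.List.Relation.Unary.Unique.Propositional.Properties as Unique
open import Data.Nat as ℕ using (ℕ; zero; suc; _∸_; _<_; _≤_; z≤n; s≤s; ⌊_/2⌋; _<?_)
open import Data.Nat.Combinatorics
open import Data.Nat.Properties
open import Data.Product using (∃-syntax; _×_; _,_)
open import Data.Sum using (inj₁; inj₂)
open import Data.Vec using ([]; _∷_)
open import Data.Vec.Functional using (Vector)
open import Data.Vec.Properties using (∷-injective; ∷-injectiveʳ)
open import Function using (_∘_)
open import Relation.Binary.PropositionalEquality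
open import Relation.Nullary using (¬_; Dec; yes; no; does)
open import Relation.Nullary.Decidable using (dec-true; dec-false)
open import Algebra.Properties.CommutativeMonoid.Sum ℤₚ.+-0-commutativeMonoid
  using (sum; sum-cong-≗; ∑-distrib-+; sum-replicate-zero)

open ≡-Reasoning

-- Coefficients of polynomials

-- Multiplication by `X`, as a reindexing instead of a convolution.
shift : Poly → Poly
shift p zero    = + 0
shift p (suc k) = p k

shift-cong : ∀ {p q} → p ≗ q → shift p ≗ shift q
shift-cong p≗q zero    = refl
shift-cong p≗q (suc k) = p≗q k

shiftBy : ℕ → Poly → Poly
shiftBy zero    p = p
shiftBy (suc j) p = shift (shiftBy j p)

shiftBy-cong : ∀ j {p q} → p ≗ q → shiftBy j p ≗ shiftBy j q
shiftBy-cong zero    p≗q = p≗q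
shiftBy-cong (suc j) p≗q = shift-cong (shiftBy-cong j p≗q)

*ₚ-congˡ : ∀ {p q} r → p ≗ q → p *ₚ r ≗ q *ₚ r
*ₚ-congˡ r p≗q k = sum-cong-≗ {suc k} λ i → cong (ℤ._* r (k ∸ toℕ i)) (p≗q (toℕ i))

*ₚ-distribʳ-+ₚ : ∀ p q r → (p +ₚ q) *ₚ r ≗ p *ₚ r +ₚ q *ₚ r
*ₚ-distribʳ-+ₚ p q r k = trans
  (sum-cong-≗ {suc k} λ i → ℤₚ.*-distribʳ-+ (r (k ∸ toℕ i)) (p (toℕ i)) (q (toℕ i)))
  (∑-distrib-+ {suc k} (λ i → p (toℕ i) ℤ.* r (k ∸ toℕ i)) (λ i → q (toℕ i) ℤ.* r (k ∸ toℕ i)))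

*ₚ-identityˡ : ∀ p → 1ₚ *ₚ p ≗ p
*ₚ-identityˡ p k = trans
  (cong₂ ℤ._+_ (ℤₚ.*-identityˡ (p k)) (sum-replicate-zero k))
  (ℤₚ.+-identityʳ (p k))

shift-*ₚ : ∀ p q → shift p *ₚ q ≗ shift (p *ₚ q)
shift-*ₚ p q zero    = refl
shift-*ₚ p q (suc k) = ℤₚ.+-identityˡ ((p *ₚ q) k)

X≗shift : X ≗ shift 1ₚ
X≗shift zero          = refl
X≗shift (suc zero)    = refl
X≗shift (suc (suc k)) = refl

X*ₚ : ∀ p → X *ₚ p ≗ shift p
X*ₚ p k = begin
  (X *ₚ p) k          ≡⟨ *ₚ-congˡ p X≗shift k ⟩
  (shift 1ₚ *ₚ p) k   ≡⟨ shift-*ₚ 1ₚ p k ⟩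
  shift (1ₚ *ₚ p) k   ≡⟨ shift-cong (*ₚ-identityˡ p) k ⟩
  shift p k           ∎

X^ₚ*ₚ : ∀ j p → X ^ₚ j *ₚ p ≗ shiftBy j p
X^ₚ*ₚ zero    p k = *ₚ-identityˡ p k
X^ₚ*ₚ (suc j) p k = begin
  ((X *ₚ X ^ₚ j) *ₚ p) k      ≡⟨ *ₚ-congˡ p (X*ₚ (X ^ₚ j)) k ⟩
  (shift (X ^ₚ j) *ₚ p) k     ≡⟨ shift-*ₚ (X ^ₚ j) p k ⟩
  shift (X ^ₚ j *ₚ p) k       ≡⟨ shift-cong (X^ₚ*ₚ j p) k ⟩
  shift (shiftBy j p) k       ∎

-- Binomial coefficients and backward differences

binomial : ℕ → Poly
binomial n k = + (n C k)

nC0≡1 : ∀ n → n C 0 ≡ 1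
nC0≡1 n = trans (nCk≡nC[n∸k] (z≤n {n})) (nCn≡1 n)

-- Pascal's rule; `shift` supplies the zero to the left of each row.
binomial-suc : ∀ n → binomial (suc n) ≗ binomial n +ₚ shift (binomial n)
binomial-suc n zero    = cong +_ (trans (nC0≡1 (suc n)) (sym (trans (+-identityʳ _) (nC0≡1 n))))
binomial-suc n (suc k) = trans
  (cong +_ (trans (sym (nCk+nC[k+1]≡[n+1]C[k+1] n k)) (+-comm (n C k) (n C suc k))))
  (ℤₚ.pos-+ (n C suc k) (n C k))

[1+X]^ₚ : ∀ n → (1ₚ +ₚ X) ^ₚ n ≗ binomial n
[1+X]^ₚ zero    zero    = refl
[1+X]^ₚ zero    (suc k) = refl
[1+X]^ₚ (suc n) k = begin
  ((1ₚ +ₚ X) *ₚ p) k                  ≡⟨ *ₚ-distribʳ-+ₚ 1ₚ X p k ⟩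
  (1ₚ *ₚ p) k ℤ.+ (X *ₚ p) k          ≡⟨ cong₂ ℤ._+_ (*ₚ-identityˡ p k) (X*ₚ p k) ⟩
  p k ℤ.+ shift p k                   ≡⟨ cong₂ ℤ._+_ ([1+X]^ₚ n k) (shift-cong ([1+X]^ₚ n) k) ⟩
  binomial n k ℤ.+ shift (binomial n) k ≡⟨ binomial-suc n k ⟨
  binomial (suc n) k                  ∎
  where p = (1ₚ +ₚ X) ^ₚ n

-- Multiplication by `1 - t`, so that the g-vector is the lower half of `∇` applied to `h`.
∇ : Poly → Poly
∇ p zero    = p zero
∇ p (suc k) = p (suc k) ℤ.- p k

∇-cong : ∀ {p q} → p ≗ q → ∇ p ≗ ∇ q
∇-cong p≗q zero    = p≗q zero
∇-cong p≗q (suc k) = cong₂ ℤ._-_ (p≗q (suc k)) (p≗q k)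

∇-+ₚ : ∀ p q → ∇ (p +ₚ q) ≗ ∇ p +ₚ ∇ q
∇-+ₚ p q zero    = refl
∇-+ₚ p q (suc k) = interchange (p (suc k)) (q (suc k)) (p k) (q k)
  where
  interchange : ∀ a b c d → (a ℤ.+ b) ℤ.- (c ℤ.+ d) ≡ (a ℤ.- c) ℤ.+ (b ℤ.- d)
  interchange = solve-∀

∇-shift : ∀ p → ∇ (shift p) ≗ shift (∇ p)
∇-shift p zero          = refl
∇-shift p (suc zero)    = ℤₚ.+-identityʳ (p zero)
∇-shift p (suc (suc k)) = refl

∇-· : ∀ c p → ∇ (c ·ₚ p) ≗ c ·ₚ ∇ p
∇-· c p zero    = refl
∇-· c p (suc k) = factor c (p (suc k)) (p k)
  where
  factor : ∀ c a b → c ℤ.* a ℤ.- c ℤ.* b ≡ c ℤ.* (a ℤ.- b)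
  factor = solve-∀

∇-0 : ∀ k → ∇ (λ _ → + 0) k ≡ + 0
∇-0 zero    = refl
∇-0 (suc k) = refl

∇-∑ₚ : ∀ {n} (ps : Vector Poly n) → ∇ (∑ₚ ps) ≗ ∑ₚ (∇ ∘ ps)
∇-∑ₚ {zero}  ps k = ∇-0 k
∇-∑ₚ {suc n} ps k = trans
  (∇-+ₚ (ps zero) (∑ₚ (ps ∘ suc)) k)
  (cong (ℤ._+_ (∇ (ps zero) k)) (∇-∑ₚ (ps ∘ suc) k))

-- Face numbers of truncated cones

-- Multiplication by `1 + t`, except that only entries of degree below `c` get multiplied by `t`.
-- Over the integers this is a linear operator, so it can act on each term of a sum separately.
coneVector : ℕ → Poly → Poly
coneVector c a zero    = a zero
coneVector c a (suc i) = a (suc i) ℤ.+ (if does (i <? c) then a i else + 0)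

coneVector-< : ∀ {c i} a → i < c → coneVector c a (suc i) ≡ a (suc i) ℤ.+ a i
coneVector-< {c} {i} a i<c =
  cong (λ b → a (suc i) ℤ.+ (if b then a i else + 0)) (dec-true (i <? c) i<c)

coneVector-≥ : ∀ {c i} a → c ≤ i → coneVector c a (suc i) ≡ a (suc i)
coneVector-≥ {c} {i} a c≤i = trans
  (cong (λ b → a (suc i) ℤ.+ (if b then a i else + 0)) (dec-false (i <? c) (≤⇒≯ c≤i)))
  (ℤₚ.+-identityʳ (a (suc i)))

coneVector-cong : ∀ c {a b} → a ≗ b → coneVector c a ≗ coneVector c b
coneVector-cong c a≗b zero    = a≗b zero
coneVector-cong c a≗b (suc i) =
  cong₂ (λ x y → x ℤ.+ (if does (i <? c) then y else + 0)) (a≗b (suc i)) (a≗b i)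

-- Each entry moves up by one degree, so the bound must move up with it. This lets one shift balance
-- a decrease of the stage by 2.
coneVector-shift : ∀ c a → coneVector (suc c) (shift a) ≗ shift (coneVector c a)
coneVector-shift c a zero          = refl
coneVector-shift c a (suc zero)    = ℤₚ.+-identityʳ (a zero)
coneVector-shift c a (suc (suc i)) = refl

coneVector-+ₚ : ∀ c a b → coneVector c (a +ₚ b) ≗ coneVector c a +ₚ coneVector c b
coneVector-+ₚ c a b zero    = refl
coneVector-+ₚ c a b (suc i) with does (i <? c)
... | true  = interchange (a (suc i)) (b (suc i)) (a i) (b i)
  where
  interchange : ∀ x y z w → (x ℤ.+ y) ℤ.+ (z ℤ.+ w) ≡ (x ℤ.+ z) ℤ.+ (y ℤ.+ w)
  interchange = solve-∀
... | false = interchange (a (suc i)) (b (suc i))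
  where
  interchange : ∀ x y → (x ℤ.+ y) ℤ.+ + 0 ≡ (x ℤ.+ + 0) ℤ.+ (y ℤ.+ + 0)
  interchange = solve-∀

coneVector-· : ∀ c x a → coneVector c (x ·ₚ a) ≗ x ·ₚ coneVector c a
coneVector-· c x a zero    = refl
coneVector-· c x a (suc i) with does (i <? c)
... | true  = sym (ℤₚ.*-distribˡ-+ x (a (suc i)) (a i))
... | false = trans (ℤₚ.+-identityʳ _) (cong (x ℤ.*_) (sym (ℤₚ.+-identityʳ (a (suc i)))))

coneVector-0 : ∀ c → coneVector c (λ _ → + 0) ≗ λ _ → + 0
coneVector-0 c zero    = refl
coneVector-0 c (suc i) with does (i <? c)
... | true  = refl
... | false = refl

coneVector-∑ₚ : ∀ c {n} (as : Vector Poly n) → coneVector c (∑ₚ as) ≗ ∑ₚ (coneVector c ∘ as)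
coneVector-∑ₚ c {zero}  as i = coneVector-0 c i
coneVector-∑ₚ c {suc n} as i = trans
  (coneVector-+ₚ c (as zero) (∑ₚ (as ∘ suc)) i)
  (cong (ℤ._+_ (coneVector c (as zero) i)) (coneVector-∑ₚ c (as ∘ suc) i))

-- Ballot numbers

-- `ballot q k` counts the sequences of `q` up and down steps with `k` down steps that never go
-- below the start: a down step at time `q + 1` is allowed only if at most half of the steps so far,
-- itself included, are down.
ballot : ℕ → Poly
ballot zero    = 1ₚ
ballot (suc q) = coneVector ⌊ suc q /2⌋ (ballot q)

⌊n/2⌋≤⌊1+n/2⌋ : ∀ n → ⌊ n /2⌋ ≤ ⌊ suc n /2⌋
⌊n/2⌋≤⌊1+n/2⌋ n = ⌊n/2⌋-mono (n≤1+n n)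

ballot-vanishes : ∀ q k → ⌊ q /2⌋ < k → ballot q k ≡ + 0
ballot-vanishes zero    (suc k) _         = refl
ballot-vanishes (suc q) (suc k) (s≤s c≤k) = trans
  (coneVector-≥ (ballot q) c≤k)
  (ballot-vanishes q (suc k) (s≤s (≤-trans (⌊n/2⌋≤⌊1+n/2⌋ q) c≤k)))

∇binomial-suc : ∀ q k → ∇ (binomial (suc q)) (suc k) ≡
  ∇ (binomial q) (suc k) ℤ.+ ∇ (binomial q) k
∇binomial-suc q k = begin
  ∇ (binomial (suc q)) (suc k)                          ≡⟨ ∇-cong (binomial-suc q) (suc k) ⟩
  ∇ (binomial q +ₚ shift (binomial q)) (suc k)          ≡⟨ ∇-+ₚ (binomial q) (shift (binomial q)) (suc k) ⟩
  (∇ (binomial q) +ₚ ∇ (shift (binomial q))) (suc k)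
    ≡⟨ cong (ℤ._+_ (∇ (binomial q) (suc k))) (∇-shift (binomial q) (suc k)) ⟩
  ∇ (binomial q) (suc k) ℤ.+ ∇ (binomial q) k           ∎

-- The bounds force `q = 2k`, so these are the two equal middle entries of the odd row `2k + 1`.
binomial-middle : ∀ q k → ⌊ suc q /2⌋ ≤ k → k ≤ ⌊ q /2⌋ → suc q C suc k ≡ suc q C k
binomial-middle q k ⌈q/2⌉≤k k≤⌊q/2⌋ = begin
  suc q C suc k            ≡⟨ nCk≡nC[n∸k] (s≤s (≤-trans k≤⌊q/2⌋ (⌊n/2⌋≤n q))) ⟩
  suc q C (q ∸ k)          ≡⟨ cong (λ n → suc q C (n ∸ k)) q≡k+k ⟩
  suc q C (k ℕ.+ k ∸ k)    ≡⟨ cong (suc q C_) (m+n∸n≡m k k) ⟩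
  suc q C k                ∎
  where
  q≡k+k : q ≡ k ℕ.+ k
  q≡k+k = trans (sym (⌊n/2⌋+⌈n/2⌉≡n q)) (cong₂ ℕ._+_
    (≤-antisym (≤-trans (⌊n/2⌋≤⌈n/2⌉ q) ⌈q/2⌉≤k) k≤⌊q/2⌋)
    (≤-antisym ⌈q/2⌉≤k (≤-trans k≤⌊q/2⌋ (⌊n/2⌋≤⌈n/2⌉ q))))

-- Both sides obey Pascal's recursion as long as the truncation does not act. The range goes up to
-- half of `q` rounded up, because the induction step reads row `q` at `suc k`; for odd `q` the
-- extra entry is zero on both sides.
ballot≡∇binomial : ∀ q k → k ≤ ⌊ suc q /2⌋ → ballot q k ≡ ∇ (binomial q) k
ballot≡∇binomial zero    zero    _ = refl
ballot≡∇binomial (suc q) zero    _ = trans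
  (ballot≡∇binomial q zero z≤n)
  (cong +_ (trans (nC0≡1 q) (sym (nC0≡1 (suc q)))))
ballot≡∇binomial (suc q) (suc k) (s≤s k≤⌊q/2⌋) with k <? ⌊ suc q /2⌋
... | yes k<⌈q/2⌉ = begin
  ballot (suc q) (suc k)                        ≡⟨ coneVector-< (ballot q) k<⌈q/2⌉ ⟩
  ballot q (suc k) ℤ.+ ballot q k
    ≡⟨ cong₂ ℤ._+_ (ballot≡∇binomial q (suc k) k<⌈q/2⌉) (ballot≡∇binomial q k (<⇒≤ k<⌈q/2⌉)) ⟩
  ∇ (binomial q) (suc k) ℤ.+ ∇ (binomial q) k   ≡⟨ ∇binomial-suc q k ⟨
  ∇ (binomial (suc q)) (suc k)                  ∎
-- Here `q = 2k`: the down step is forbidden, and the difference of the two middle binomials is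
-- zero.
... | no  k≮⌈q/2⌉ = begin
  ballot (suc q) (suc k)                        ≡⟨ coneVector-≥ (ballot q) ⌈q/2⌉≤k ⟩
  ballot q (suc k)
    ≡⟨ ballot-vanishes q (suc k) (s≤s (≤-trans (⌊n/2⌋≤⌊1+n/2⌋ q) ⌈q/2⌉≤k)) ⟩
  + 0                                           ≡⟨ ℤₚ.+-inverseʳ (binomial (suc q) k) ⟨
  binomial (suc q) k ℤ.- binomial (suc q) k
    ≡⟨ cong (λ n → + n ℤ.- binomial (suc q) k) (binomial-middle q k ⌈q/2⌉≤k k≤⌊q/2⌋) ⟨
  ∇ (binomial (suc q)) (suc k)                  ∎
  where ⌈q/2⌉≤k = ≮⇒≥ k≮⌈q/2⌉

-- The contribution of a single monomial of degree j.  Truncated subtraction is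
-- harmless: for p ≤ 2j no variable can be added yet.
shiftedBallot : ℕ → ℕ → Poly
shiftedBallot zero    p = ballot p
shiftedBallot (suc j) p = shift (shiftedBallot j (p ∸ 2))

-- The recursion has the same bound for every `j`, since lowering `p` by 2 lowers its half by 1.
-- Hence a single operator advances all the contributions at once.
shiftedBallot-suc : ∀ j p →
  shiftedBallot j (suc p) ≗ coneVector ⌊ suc p /2⌋ (shiftedBallot j p)
shiftedBallot-suc zero    p             i             = refl
shiftedBallot-suc (suc j) p             zero          = refl
-- For `p` at most 1 the bound admits at most the entry of degree 0, which is zero after a shift.
shiftedBallot-suc (suc j) zero          (suc i)       = sym (coneVector-≥ (shiftedBallot (suc j) 0) z≤n)
shiftedBallot-suc (suc j) (suc zero)    (suc zero)    = sym (ℤₚ.+-identityʳ (shiftedBallot j 0 0))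
shiftedBallot-suc (suc j) (suc zero)    (suc (suc i)) = sym (coneVector-≥ (shiftedBallot (suc j) 1) (s≤s z≤n))
shiftedBallot-suc (suc j) (suc (suc p)) (suc i)       = trans
  (shiftedBallot-suc j p i)
  (sym (coneVector-shift ⌊ suc p /2⌋ (shiftedBallot j p) (suc i)))

shiftedBallot≡∇ : ∀ j p i → i ≤ ⌊ p /2⌋ →
  shiftedBallot j p i ≡ ∇ (shiftBy j (binomial (p ∸ 2 ℕ.* j))) i
shiftedBallot≡∇ zero    p             i       i≤p/2 =
  ballot≡∇binomial p i (≤-trans i≤p/2 (⌊n/2⌋≤⌊1+n/2⌋ p))
shiftedBallot≡∇ (suc j) p             zero    _     = refl
shiftedBallot≡∇ (suc j) (suc (suc p)) (suc i) (s≤s i≤p/2) = begin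
  shiftedBallot j p i                                              ≡⟨ shiftedBallot≡∇ j p i i≤p/2 ⟩
  ∇ (shiftBy j (binomial (p ∸ 2 ℕ.* j))) i                         ≡⟨ ∇-shift _ (suc i) ⟨
  ∇ (shiftBy (suc j) (binomial (p ∸ 2 ℕ.* j))) (suc i)
    ≡⟨ cong (λ n → ∇ (shiftBy (suc j) (binomial (suc (suc p) ∸ n))) (suc i)) (*-suc 2 j) ⟨
  ∇ (shiftBy (suc j) (binomial (suc (suc p) ∸ 2 ℕ.* suc j))) (suc i) ∎

-- `shiftedBallot j 0` is the power `t^j`, so this is the expansion of `a` in powers of `t`.
∑-shiftedBallot-0 : ∀ m (a : Poly) → (∀ i → m ≤ i → a i ≡ + 0) →
  ∑ₚ {m} (λ j → a (toℕ j) ·ₚ shiftedBallot (toℕ j) 0) ≗ a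
∑-shiftedBallot-0 zero    a a≡0 i       = sym (a≡0 i z≤n)
∑-shiftedBallot-0 (suc m) a a≡0 zero    = begin
  a 0 ℤ.* + 1 ℤ.+ sum {m} (λ j → a (suc (toℕ j)) ℤ.* + 0)
    ≡⟨ cong₂ ℤ._+_ (ℤₚ.*-identityʳ (a 0)) (sum-cong-≗ {m} (λ j → ℤₚ.*-zeroʳ (a (suc (toℕ j))))) ⟩
  a 0 ℤ.+ sum {m} (λ _ → + 0)                              ≡⟨ cong (ℤ._+_ (a 0)) (sum-replicate-zero m) ⟩
  a 0 ℤ.+ + 0                                              ≡⟨ ℤₚ.+-identityʳ (a 0) ⟩
  a 0                                                      ∎
∑-shiftedBallot-0 (suc m) a a≡0 (suc i) = trans
  (cong₂ ℤ._+_ (ℤₚ.*-zeroʳ (a 0)) (∑-shiftedBallot-0 m (a ∘ suc) (λ k m≤k → a≡0 (suc k) (s≤s m≤k)) i))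
  (ℤₚ.+-identityˡ (a (suc i)))

-- Truncated cones over multicomplexes

deg-mono-∣ : ∀ {n} {u v : Monomial n} → v ∣ u → deg v ≤ deg u
deg-mono-∣ {v = []}    ([]    , refl) = z≤n
deg-mono-∣ {v = y ∷ v} (x ∷ w , refl) = +-mono-≤ (m≤n+m y x) (deg-mono-∣ (w , refl))

∣-refl : ∀ {n} (u : Monomial n) → u ∣ u
∣-refl []      = [] , refl
∣-refl (x ∷ u) with ∣-refl u
... | w , w·u≡u = 0 ∷ w , cong (x ∷_) w·u≡u

module _ {n} (c : ℕ) (M : Multicomplex n) where

  private
    degree<c? : (u : Monomial n) → Dec (deg u < c)
    degree<c? u = deg u <? c

    withoutVariable withVariable : List (Monomial (suc n))
    withoutVariable = map (0 ∷_) (monomials M)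
    withVariable    = map (1 ∷_) (filter degree<c? (monomials M))

  0∷-∈ : ∀ {u} → u ∈ monomials M → 0 ∷ u ∈ withoutVariable ++ withVariable
  0∷-∈ u∈M = ∈-++⁺ˡ (∈-map⁺ (0 ∷_) u∈M)

  1∷-∈ : ∀ {u} → u ∈ monomials M → deg u < c → 1 ∷ u ∈ withoutVariable ++ withVariable
  1∷-∈ u∈M u<c = ∈-++⁺ʳ withoutVariable (∈-map⁺ (1 ∷_) (∈-filter⁺ degree<c? u∈M u<c))

  -- Allows `cone` and `tower-raise` to split on the exponent of the new variable.
  data ConeView : Monomial (suc n) → Set where
    zero : ∀ {u} → u ∈ monomials M → ConeView (0 ∷ u)
    one  : ∀ {u} → u ∈ monomials M → deg u < c → ConeView (1 ∷ u)

  coneView : ∀ {u} → u ∈ withoutVariable ++ withVariable → ConeView u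
  coneView u∈ with ∈-++⁻ withoutVariable u∈
  ... | inj₁ u∈₀ with _ , v∈M , refl ← ∈-map⁻ (0 ∷_) u∈₀ = zero v∈M
  ... | inj₂ u∈₁ with _ , v∈  , refl ← ∈-map⁻ (1 ∷_) u∈₁
                 with v∈M , v<c ← ∈-filter⁻ degree<c? {xs = monomials M} v∈ = one v∈M v<c

  -- Closed under divisors because the degree bound passes from `u` to each of its divisors.
  cone : Multicomplex (suc n)
  cone .monomials = withoutVariable ++ withVariable
  cone .unique = Unique.++⁺
    (Unique.map⁺ ∷-injectiveʳ (unique M))
    (Unique.map⁺ ∷-injectiveʳ (Unique.filter⁺ degree<c? (unique M)))
    λ (u∈₀ , u∈₁) → disjoint (∈-map⁻ (0 ∷_) u∈₀) (∈-map⁻ (1 ∷_) u∈₁)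
    where
    disjoint : ∀ {u : Monomial (suc n)} {xs ys : List (Monomial n)} →
      ∃[ v ] (v ∈ xs × u ≡ 0 ∷ v) → ¬ (∃[ v ] (v ∈ ys × u ≡ 1 ∷ v))
    disjoint (_ , _ , refl) (_ , _ , ())
  cone .nonempty = map-++≢[] (nonempty M)
    where
    map-++≢[] : ∀ {xs : List (Monomial n)} {ys} → xs ≢ [] → map (0 ∷_) xs ++ ys ≢ []
    map-++≢[] {[]}    xs≢[] _  = xs≢[] refl
    map-++≢[] {_ ∷ _} _     ()
  cone .closed {v = y ∷ v} u∈ (x ∷ w , eq) = closedView x y (coneView u∈) eq
    where
    closedView : ∀ x y {u} → ConeView u → (x ℕ.+ y) ∷ (w · v) ≡ u →
      y ∷ v ∈ withoutVariable ++ withVariable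
    closedView x y (zero u∈M) eq with x+y≡0 , w·v≡u ← ∷-injective eq
      rewrite m+n≡0⇒n≡0 x x+y≡0 = 0∷-∈ (closed M u∈M (w , w·v≡u))
    closedView x y (one u∈M u<c) eq with x+y≡1 , w·v≡u ← ∷-injective eq
      -- The bound `y ≤ 1` is kept alongside `y` to exclude exponents above 1.
      with y | m+n≤o⇒n≤o x (≤-reflexive x+y≡1)
    ... | zero        | _ = 0∷-∈ (closed M u∈M (w , w·v≡u))
    ... | suc zero    | _ = 1∷-∈ (closed M u∈M (w , w·v≡u)) (≤-<-trans (deg-mono-∣ (w , w·v≡u)) u<c)
    ... | suc (suc _) | s≤s ()

-- Degree counts in a truncated cone

count : ∀ {n} → ℕ → List (Monomial n) → ℕ
count i us = length (filter (λ u → deg u ℕ.≟ i) us)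

count-++ : ∀ {n} i (us vs : List (Monomial n)) → count i (us ++ vs) ≡ count i us ℕ.+ count i vs
count-++ i us vs = trans (cong length (filter-++ _ us vs)) (length-++ (filter _ us))

count-0∷ : ∀ {n} i (us : List (Monomial n)) → count i (map (0 ∷_) us) ≡ count i us
count-0∷ i []       = refl
count-0∷ i (u ∷ us) with does (deg u ℕ.≟ i)
... | true  = cong suc (count-0∷ i us)
... | false = count-0∷ i us

count-1∷-zero : ∀ {n} (us : List (Monomial n)) → count 0 (map (1 ∷_) us) ≡ 0
count-1∷-zero []       = refl
count-1∷-zero (u ∷ us) = count-1∷-zero us

count-1∷-suc : ∀ {n} i (us : List (Monomial n)) → count (suc i) (map (1 ∷_) us) ≡ count i us
count-1∷-suc i []       = refl
count-1∷-suc i (u ∷ us) with does (deg u ℕ.≟ i)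
... | true  = cong suc (count-1∷-suc i us)
... | false = count-1∷-suc i us

count-∷ : ∀ {n} i (u : Monomial n) {us vs} → count i us ≡ count i vs → count i (u ∷ us) ≡ count i (u ∷ vs)
count-∷ i u eq with does (deg u ℕ.≟ i)
... | true  = cong suc eq
... | false = eq

count-∷-≢ : ∀ {n} {i} (u : Monomial n) us → deg u ≢ i → count i (u ∷ us) ≡ count i us
count-∷-≢ {i = i} u us u≢i = cong length (filter-reject (λ v → deg v ℕ.≟ i) {u} {us} u≢i)

count-filter-< : ∀ {n} {i c} → i < c → (us : List (Monomial n)) →
  count i (filter (λ u → deg u <? c) us) ≡ count i us
count-filter-<             i<c []       = refl
count-filter-< {i = i} {c} i<c (u ∷ us) = step (deg u <? c)
  where
  step : Dec (deg u < c) → count i (filter (λ v → deg v <? c) (u ∷ us)) ≡ count i (u ∷ us)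
  step (yes u<c) = trans
    (cong (count i) (filter-accept (λ v → deg v <? c) {u} {us} u<c))
    (count-∷ i u (count-filter-< i<c us))
  step (no u≮c)  = trans
    (cong (count i) (filter-reject (λ v → deg v <? c) {u} {us} u≮c))
    (trans (count-filter-< i<c us) (sym (count-∷-≢ u us λ u≡i → u≮c (subst (_< c) (sym u≡i) i<c))))

count-filter-≥ : ∀ {n} {i c} → c ≤ i → (us : List (Monomial n)) →
  count i (filter (λ u → deg u <? c) us) ≡ 0
count-filter-≥             c≤i []       = refl
count-filter-≥ {i = i} {c} c≤i (u ∷ us) = step (deg u <? c)
  where
  step : Dec (deg u < c) → count i (filter (λ v → deg v <? c) (u ∷ us)) ≡ 0
  step (yes u<c) = trans
    (cong (count i) (filter-accept (λ v → deg v <? c) {u} {us} u<c))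
    (trans
      (count-∷-≢ u (filter (λ v → deg v <? c) us) λ u≡i → <⇒≱ u<c (subst (c ≤_) (sym u≡i) c≤i))
      (count-filter-≥ c≤i us))
  step (no u≮c)  = trans
    (cong (count i) (filter-reject (λ v → deg v <? c) {u} {us} u≮c))
    (count-filter-≥ c≤i us)

-- A monomial of degree `i + 1` either avoids the new variable or is that variable times a monomial
-- of degree `i`, which must be below `c`.
f-cone : ∀ {n} c (M : Multicomplex n) i →
  + f i (cone c M) ≡ coneVector c (λ k → + f k M) i
f-cone c M zero = cong +_ (begin
  f 0 (cone c M)                     ≡⟨ count-++ 0 (map (0 ∷_) us) (map (1 ∷_) vs) ⟩
  count 0 (map (0 ∷_) us) ℕ.+ count 0 (map (1 ∷_) vs)  ≡⟨ cong₂ ℕ._+_ (count-0∷ 0 us) (count-1∷-zero vs) ⟩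
  f 0 M ℕ.+ 0                        ≡⟨ +-identityʳ (f 0 M) ⟩
  f 0 M                              ∎)
  where us = monomials M ; vs = filter (λ u → deg u <? c) us
f-cone {n} c M (suc i) = begin
  + f (suc i) (cone c M)
    ≡⟨ cong +_ (trans
         (count-++ (suc i) (map (0 ∷_) us) (map (1 ∷_) vs))
         (cong₂ ℕ._+_ (count-0∷ (suc i) us) (count-1∷-suc i vs))) ⟩
  + (f (suc i) M ℕ.+ count i vs)            ≡⟨ ℤₚ.pos-+ (f (suc i) M) (count i vs) ⟩
  + f (suc i) M ℤ.+ + count i vs            ≡⟨ truncate (i <? c) ⟩
  coneVector c (λ k → + f k M) (suc i)      ∎
  where
  us vs : List (Monomial n)
  us = monomials M
  vs = filter (λ u → deg u <? c) us
  truncate : Dec (i < c) → + f (suc i) M ℤ.+ + count i vs ≡ coneVector c (λ k → + f k M) (suc i)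
  truncate (yes i<c) = trans
    (cong (λ m → + f (suc i) M ℤ.+ + m) (count-filter-< i<c us))
    (sym (coneVector-< (λ k → + f k M) i<c))
  truncate (no i≮c) = trans
    (cong (λ m → + f (suc i) M ℤ.+ + m) (count-filter-≥ (≮⇒≥ i≮c) us))
    (trans (ℤₚ.+-identityʳ (+ f (suc i) M)) (sym (coneVector-≥ (λ k → + f k M) (≮⇒≥ i≮c))))

-- Iterated truncated cones

tower : ∀ {n} p → Multicomplex n → Multicomplex (p ℕ.+ n)
tower zero    M = M
tower (suc p) M = cone ⌊ suc p /2⌋ (tower p M)

-- Induction on `p`: both sides are advanced by the same linear operator, and at `p = 0` they agree
-- by expansion in powers of `t`.
f-tower : ∀ {n} (M : Multicomplex n) m → (∀ i → m ≤ i → f i M ≡ 0) → ∀ p i →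
  + f i (tower p M) ≡ ∑ₚ {m} (λ j → + f (toℕ j) M ·ₚ shiftedBallot (toℕ j) p) i
f-tower M m f≡0 zero    i =
  sym (∑-shiftedBallot-0 m (λ k → + f k M) (λ k m≤k → cong +_ (f≡0 k m≤k)) i)
f-tower M m f≡0 (suc p) i = begin
  + f i (cone c (tower p M))                                 ≡⟨ f-cone c (tower p M) i ⟩
  coneVector c (λ k → + f k (tower p M)) i                   ≡⟨ coneVector-cong c (f-tower M m f≡0 p) i ⟩
  coneVector c (∑ₚ {m} λ j → + f (toℕ j) M ·ₚ shiftedBallot (toℕ j) p) i
    ≡⟨ coneVector-∑ₚ c {m} _ i ⟩
  sum {m} (λ j → coneVector c (+ f (toℕ j) M ·ₚ shiftedBallot (toℕ j) p) i)
    ≡⟨ sum-cong-≗ {m} (λ j → trans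
         (coneVector-· c (+ f (toℕ j) M) (shiftedBallot (toℕ j) p) i)
         (cong (+ f (toℕ j) M ℤ.*_) (sym (shiftedBallot-suc (toℕ j) p i)))) ⟩
  ∑ₚ {m} (λ j → + f (toℕ j) M ·ₚ shiftedBallot (toℕ j) (suc p)) i ∎
  where c = ⌊ suc p /2⌋

-- If the newest variable is missing, the degree bound on `u` is exactly the condition for adding
-- it. Otherwise it is set aside and the remaining factor is raised one stage earlier.
tower-raise : ∀ {n} (M : Multicomplex n) p {u} → u ∈ monomials (tower p M) → deg u < ⌊ p /2⌋ →
  ∃[ v ] (v ∈ monomials (tower p M) × u ∣ v × deg v ≡ suc (deg u))
tower-raise M (suc p) u∈ u<c with coneView ⌊ suc p /2⌋ (tower p M) u∈
... | zero {u} u∈′ with w , w·u≡u ← ∣-refl u =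
  1 ∷ u , 1∷-∈ _ (tower p M) u∈′ u<c , (1 ∷ w , cong (1 ∷_) w·u≡u) , refl
... | one u∈′ u<c′
  -- Removing the variable lowers the degree by 1, while the bound drops by at most 1 from stage
  -- `p + 1` to stage `p`.
  with v , v∈ , (w , w·u≡v) , deg-v ← tower-raise M p u∈′ (≤-pred (≤-trans u<c (⌊n/2⌋-mono (n≤1+n (suc p)))))
  -- The raised factor `v` has the degree of the original monomial, still below the bound, so the
  -- variable can be put back.
  = 1 ∷ v , 1∷-∈ _ (tower p M) v∈ (subst (_< ⌊ suc p /2⌋) (sym deg-v) u<c)
  , (0 ∷ w , cong (1 ∷_) w·u≡v) , cong suc deg-v

∈⇒f≢0 : ∀ {n} (M : Multicomplex n) {u} → u ∈ monomials M → f (deg u) M ≢ 0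
∈⇒f≢0 M {u} u∈M f≡0 with filter (λ v → deg v ℕ.≟ deg u) (monomials M)
                       | ∈-filter⁺ (λ v → deg v ℕ.≟ deg u) u∈M refl
∈⇒f≢0 M {u} u∈M ()  | _ ∷ _ | _

-- Every maximal monomial has degree `⌊ d /2⌋`: nothing lies above that degree, and anything below
-- it can be raised.
tower-pure : ∀ {n} (M : Multicomplex n) d → (∀ i → ⌊ d /2⌋ < i → f i (tower d M) ≡ 0) →
  Pure (tower d M)
tower-pure M d f≡0 u v u-max v-max = trans (deg-maximal u-max) (sym (deg-maximal v-max))
  where
  deg-maximal : ∀ {u} → Maximal (tower d M) u → deg u ≡ ⌊ d /2⌋
  deg-maximal {u} (u∈ , u-max) = ≤-antisym
    (≮⇒≥ λ c<u → ∈⇒f≢0 (tower d M) u∈ (f≡0 (deg u) c<u))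
    (≮⇒≥ λ u<c → let v , v∈ , u∣v , deg-v = tower-raise M d u∈ u<c in
      1+n≢n (trans (sym deg-v) (cong deg (u-max v v∈ u∣v))))

-- Stage `p` creates only monomials of degree at most `⌊ p /2⌋`, and these bounds increase with `p`;
-- in higher degrees only monomials of `M` remain.
f-tower-vanishes : ∀ {n} (M : Multicomplex n) p {i} → ⌊ p /2⌋ < i → f i M ≡ 0 → f i (tower p M) ≡ 0
f-tower-vanishes M zero    _   f≡0 = f≡0
f-tower-vanishes M (suc p) {suc i} (s≤s c≤i) f≡0 = ℤₚ.+-injective (begin
  + f (suc i) (tower (suc p) M)                            ≡⟨ f-cone ⌊ suc p /2⌋ (tower p M) (suc i) ⟩
  coneVector ⌊ suc p /2⌋ (λ k → + f k (tower p M)) (suc i) ≡⟨ coneVector-≥ (λ k → + f k (tower p M)) c≤i ⟩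
  + f (suc i) (tower p M)
    ≡⟨ cong +_ (f-tower-vanishes M p (s≤s (≤-trans (⌊n/2⌋≤⌊1+n/2⌋ p) c≤i)) f≡0) ⟩
  + 0                                                      ∎)

-- The g-vector in terms of the γ-vector

g-vector≡∇ : ∀ d h i → g-vector d h i ≡ ∇ (λ k → + h k) (toℕ i)
g-vector≡∇ d h zero    = refl
g-vector≡∇ d h (suc i) = refl

g-vector-γ : ∀ d h (γ : Vector ℤ (suc ⌊ d /2⌋)) → Isγ-vector d h γ → ∀ i →
  g-vector d h i ≡ ∑ₚ (λ j → γ j ·ₚ shiftedBallot (toℕ j) d) (toℕ i)
g-vector-γ d h γ isγ i = begin
  g-vector d h i                                        ≡⟨ g-vector≡∇ d h i ⟩
  ∇ (λ k → + h k) (toℕ i)                               ≡⟨ ∇-cong isγ (toℕ i) ⟩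
  ∇ (∑ₚ (λ j → γ j ·ₚ basis j)) (toℕ i)                 ≡⟨ ∇-∑ₚ (λ j → γ j ·ₚ basis j) (toℕ i) ⟩
  ∑ₚ (λ j → ∇ (γ j ·ₚ basis j)) (toℕ i)
    ≡⟨ sum-cong-≗ (λ j → trans (∇-· (γ j) (basis j) (toℕ i)) (cong (γ j ℤ.*_) (∇-basis j))) ⟩
  ∑ₚ (λ j → γ j ·ₚ shiftedBallot (toℕ j) d) (toℕ i)     ∎
  where
  basis : Vector Poly (suc ⌊ d /2⌋)
  basis j = X ^ₚ toℕ j *ₚ (1ₚ +ₚ X) ^ₚ (d ∸ 2 ℕ.* toℕ j)
  ∇-basis : ∀ j → ∇ (basis j) (toℕ i) ≡ shiftedBallot (toℕ j) d (toℕ i)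
  ∇-basis j = trans
    (∇-cong (λ k → trans (X^ₚ*ₚ (toℕ j) _ k) (shiftBy-cong (toℕ j) ([1+X]^ₚ (d ∸ 2 ℕ.* toℕ j)) k)) (toℕ i))
    -- The index type of the g-vector gives `i ≤ ⌊ d /2⌋`, the range in which ballot numbers are
    -- differences of binomials.
    (sym (shiftedBallot≡∇ (toℕ j) d (toℕ i) (≤-pred (toℕ<n i))))

theorem1p7 : (d : ℕ) (h : ℕ → ℕ) → HasDegree d h → Palindromic d h →
    (γ : Vector ℤ (suc ⌊ d /2⌋)) → Isγ-vector d h γ →
    IsOSequence γ → IsPureOSequence (g-vector d h)
theorem1p7 d h _ _ γ isγ (n , M , f≡γ , f≡0) =
  d ℕ.+ n , tower d M , tower-pure M d vanishes , f≡g , vanishes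
  where
  vanishes : ∀ i → ⌊ d /2⌋ < i → f i (tower d M) ≡ 0
  vanishes i c<i = f-tower-vanishes M d c<i (f≡0 i c<i)
  f≡g : ∀ i → + f (toℕ i) (tower d M) ≡ g-vector d h i
  f≡g i = begin
    + f (toℕ i) (tower d M)
      -- With one more than `⌊ d /2⌋` as the number of terms, `f≡0` fits as it stands, because
      -- `⌊ d /2⌋ < i` unfolds to `suc ⌊ d /2⌋ ≤ i`.
      ≡⟨ f-tower M (suc ⌊ d /2⌋) f≡0 d (toℕ i) ⟩
    ∑ₚ {suc ⌊ d /2⌋} (λ j → + f (toℕ j) M ·ₚ shiftedBallot (toℕ j) d) (toℕ i)
      ≡⟨ sum-cong-≗ {suc ⌊ d /2⌋} (λ j → cong (ℤ._* shiftedBallot (toℕ j) d (toℕ i)) (f≡γ j)) ⟩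
    ∑ₚ (λ j → γ j ·ₚ shiftedBallot (toℕ j) d) (toℕ i)
      ≡⟨ g-vector-γ d h γ isγ i ⟨
    g-vector d h i ∎
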